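{- Let $\varepsilon>0$ be a constant. On every finite simple undirected graph with $n$ vertices and $m$ edges, ADG performs $O(n+m)$ work in the CRCW setting.
   Context: Graphs are stored in adjacency-array (CSR) form. Cost model: a parallel computation is a directed acyclic graph (DAG) of constant-time operations; its work is the number of nodes and its depth is the length of the longest directed path. In the CRCW setting concurrent reads, concurrent writes and atomic read-modify-write operations (e.g. atomic decrement-and-fetch) to the same memory cell take $O(1)$ time. Hidden constants may depend on $\varepsilon$. For $U\subseteq V$, $N_U(v)$ denotes the set of neighbors of $v$ in $U$. Algorithm ADG (parameter $\varepsilon$, input $G=(V,E)$). Initialize $U=V$, $D[v]=\deg(v)$ for all $v$, $\ell=1$. While $U\neq\emptyset$: compute $|U|$ and $\sum_{v\in U}D[v]$ by parallel reductions, and $\widehat\delta=\frac1{|U|}\sum_{v\in U}D[v]$; set $R=\{u\in U: D[u]\le(1+\varepsilon)\widehat\delta\}$; for all $v\in R$ and all $u\in N_U(v)$ in parallel, atomically decrement $D[u]$; set $U=U\setminus R$; set $\rho_{\mathrm{ADG}}(v)=\ell$ for all $v\in R$ in parallel; set $\ell=\ell+1$. Implementation assumptions: membership in $U$ and $R$ is tested in $O(1)$; in each iteration the reductions over $U$ and the construction of $R$ take $O(|U|)$ work, and the removal $U\setminus R$ takes $O(|R|)$ work; the degree update takes work proportional to $\sum_{v\in R}\deg(v)$. -}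

module Defs where

open import Algebra.Bundles using (CommutativeRing)
import Algebra.Definitions.RawMonoid as RawMonoidDefs
open import Data.Bool.Base using (if_then_else_)
import Data.Fin.Base as Fin
open import Data.Fin.Base using (Fin; _↑ˡ_; _↑ʳ_)
import Data.Fin.Properties as Fin
open import Data.Fin.Subset using (Subset; _∈_; _∉_; ∣_∣; _∩_; _─_; Nonempty; Empty) renaming (⊤ to full)
open import Data.Fin.Subset.Properties using (_∈?_)
open import Data.Graph.Acyclic using (Graph; ∅; _&_; context)
open import Data.List.Base as List using (List; allFin; cartesianProduct; concatMap; filter; foldr; length; _++_)
open import Data.Maybe.Base using (Maybe; just; nothing)
open import Data.Nat.Base as ℕ using (ℕ; zero; suc; pred)
open import Data.Nat.ListAction using (sum)
open import Data.Product.Base using (∃; _×_; _,_; map₂)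
open import Data.Unit.Base using (⊤; tt)
import Data.Vec.Base as Vec
open import Data.Vec.Functional using (Vector; updateAt)
open import Level using (Level; _⊔_) renaming (suc to lsuc)
open import Relation.Binary.Core using (Rel)
open import Relation.Binary.Structures using (IsDecTotalOrder)
open import Relation.Nullary.Decidable.Core using (does; _×-dec_)
open import Relation.Nullary.Negation.Core using (¬_)
import Relation.Binary.Construct.NonStrictToStrict as NonStrictToStrict

-- The field from which ε is drawn.  Classically ℝ is an instance, and every
-- instance embeds in ℝ, so an element of such a field is a real number for
-- which the comparison made by the algorithm can be evaluated.
record ArchimedeanOrderedField c ℓ₁ ℓ₂ : Set (lsuc (c ⊔ ℓ₁ ⊔ ℓ₂)) where
  infix 4 _≤_
  infix 9 _⁻¹
  field
    commutativeRing : CommutativeRing c ℓ₁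

  open CommutativeRing commutativeRing public

  -- The value of 0# ⁻¹ is irrelevant.
  field
    _⁻¹             : Carrier → Carrier
    ⁻¹-cong         : ∀ {x y} → x ≈ y → x ⁻¹ ≈ y ⁻¹
    ⁻¹-inverseʳ     : ∀ {x} → ¬ (x ≈ 0#) → x * x ⁻¹ ≈ 1#
    0≉1             : ¬ (0# ≈ 1#)
    _≤_             : Rel Carrier ℓ₂
    isDecTotalOrder : IsDecTotalOrder _≈_ _≤_
    +-monoʳ-≤       : ∀ x {y z} → y ≤ z → x + y ≤ x + z
    *-nonNegative   : ∀ {x y} → 0# ≤ x → 0# ≤ y → 0# ≤ x * y

  open IsDecTotalOrder isDecTotalOrder public using (_≤?_)
  open NonStrictToStrict _≈_ _≤_ public using (_<_)

  Positive : Carrier → Set (ℓ₁ ⊔ ℓ₂)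
  Positive x = 0# < x

  fromℕ : ℕ → Carrier
  fromℕ k = RawMonoidDefs._×_ +-rawMonoid k 1#

  field
    archimedean : ∀ x → ∃ λ k → x ≤ fromℕ k

elements : ∀ {n} → Subset n → List (Fin n)
elements p = filter (_∈? p) (allFin _)

record SimpleGraph (n : ℕ) : Set where
  field
    N      : Fin n → Subset n
    irrefl : ∀ {v} → v ∉ N v
    sym    : ∀ {u v} → u ∈ N v → v ∈ N u

  deg : Fin n → ℕ
  deg v = ∣ N v ∣

  edges : List (Fin n × Fin n)
  edges = filter (λ (u , v) → (u Fin.<? v) ×-dec (v ∈? N u))
                 (cartesianProduct (allFin n) (allFin n))

  edgeCount : ℕ
  edgeCount = length edges

-- A parallel computation: nodes are constant-time operations, edges are
-- dependencies.
record Computation : Set where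
  constructor computation
  field
    {work} : ℕ
    dag    : Graph ⊤ ⊤ work

open Computation public

-- Sequential composition: every operation of the second computation depends
-- on every operation of the first.
infixr 5 _⨾ᴳ_ _⨾_

_⨾ᴳ_ : ∀ {a b} → Graph ⊤ ⊤ a → Graph ⊤ ⊤ b → Graph ⊤ ⊤ (a ℕ.+ b)
∅ ⨾ᴳ h = h
_⨾ᴳ_ {suc a} {b} (context l ss & g) h =
  context l (List.map (map₂ (_↑ˡ b)) ss ++
             List.map (λ j → tt , a ↑ʳ j) (allFin b)) & (g ⨾ᴳ h)

_⨾_ : Computation → Computation → Computation
c ⨾ d = computation (dag c ⨾ᴳ dag d)

-- The variables of ADG.  ρ is nothing at vertices not yet ranked.
record State (n : ℕ) : Set where
  field
    U : Subset n
    D : Vector ℕ n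
    ρ : Vector (Maybe ℕ) n
    ℓ : ℕ

open State public

initial : ∀ {n} → SimpleGraph n → State n
initial G = record { U = full ; D = SimpleGraph.deg G ; ρ = λ _ → nothing ; ℓ = 1 }

-- The concurrent atomic decrements, in one of the possible serialisations
-- (they commute).  On reachable states D[u] counts the neighbours of u in U
-- whenever u ∈ U, so pred is never applied to 0.
decrement : ∀ {n} → List (Fin n) → Vector ℕ n → Vector ℕ n
decrement us D₀ = foldr (λ u D′ → updateAt D′ u pred) D₀ us

data Phase : Set where
  testU reduceU averageD selectR updateD removeR assignρ incrementℓ : Phase

module Algorithm {a ℓ₁ ℓ₂ : Level} (F : ArchimedeanOrderedField a ℓ₁ ℓ₂)
                 (ε : ArchimedeanOrderedField.Carrier F) where

  open ArchimedeanOrderedField F using (Carrier; _+_; _*_; _⁻¹; 1#; _≤?_; fromℕ)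

  -- Only evaluated when U is nonempty.
  δ̂ : ∀ {n} → State n → Carrier
  δ̂ s = fromℕ ∣ U s ∣ ⁻¹ * fromℕ (sum (List.map (D s) (elements (U s))))

  R : ∀ {n} → State n → Subset n
  R s = Vec.tabulate λ u →
    does ((u ∈? U s) ×-dec (fromℕ (D s u) ≤? (1# + ε) * δ̂ s))

  module _ {n : ℕ} (G : SimpleGraph n) where
    open SimpleGraph G

    step : State n → State n
    step s = record
      { U = U s ─ R s
      ; D = decrement (concatMap (λ v → elements (N v ∩ U s)) (elements (R s))) (D s)
      ; ρ = λ v → if does (v ∈? R s) then just (ℓ s) else ρ s v
      ; ℓ = suc (ℓ s)
      }

    budget : Phase → State n → ℕ
    budget testU      s = 1
    budget reduceU    s = ∣ U s ∣
    budget averageD   s = 1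
    budget selectR    s = ∣ U s ∣
    budget updateD    s = sum (List.map deg (elements (R s)))
    budget removeR    s = ∣ R s ∣
    budget assignρ    s = ∣ R s ∣
    budget incrementℓ s = 1

  -- An implementation supplies the computation of each phase, started in a
  -- given state, subject to the assumed work bounds with hidden constant κ.
  -- Degrees are differences of adjacent CSR offsets, hence the bound for
  -- initialise; suc covers the scalar assignments.
  record Implementation : Set where
    field
      κ          : ℕ
      initialise : ∀ {n} → SimpleGraph n → Computation
      perform    : ∀ {n} → SimpleGraph n → Phase → State n → Computation
      initialise-work : ∀ {n} (G : SimpleGraph n) →
                        work (initialise G) ℕ.≤ κ ℕ.* suc n
      perform-work    : ∀ {n} (G : SimpleGraph n) p s →
                        work (perform G p s) ℕ.≤ κ ℕ.* budget G p s

  module _ (I : Implementation) {n : ℕ} (G : SimpleGraph n) where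
    open Implementation I

    body : State n → Computation
    body s = perform G reduceU s ⨾ perform G averageD s ⨾ perform G selectR s
           ⨾ perform G updateD s ⨾ perform G removeR s
           ⨾ perform G assignρ s ⨾ perform G incrementℓ s

    -- Loop s c: the while loop started in s terminates, performing c.  For
    -- each s there is at most one such c.
    data Loop : State n → Computation → Set where
      exit    : ∀ {s} → Empty (U s) → Loop s (perform G testU s)
      iterate : ∀ {s c} → Nonempty (U s) → Loop (step G s) c →
                Loop s (perform G testU s ⨾ body s ⨾ c)

    data ADG : Computation → Set where
      run : ∀ {c} → Loop (initial G) c → ADG (initialise G ⨾ c)

{-# OPTIONS --safe #-}

-- Let S be the sum of D over U and choose a positive k with k ε ≥ 1.  A vertex
-- v of U is left out of R only if D[v] > (1 + ε) S / ∣U∣, so that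
-- k ∣U∣ D[v] > (k + 1) S; summing over U ─ R gives (k + 1) ∣U ─ R∣ ≤ k ∣U∣,
-- that is ∣U∣ ≤ (k + 1) ∣R∣.  This holds for every D whatsoever.  Hence an
-- iteration is paid for by the vertices it removes, at a price of
-- O(1) + deg v for v, and the prices of all vertices add up to O(n + m) by the
-- handshake lemma.
module Submission where

import Algebra.Properties.CommutativeSemigroup as CommutativeSemigroupProperties
import Algebra.Properties.Ring as RingProperties
import Algebra.Properties.Semiring.Mult as Mult
open import Data.Bool.Base using (true; false; if_then_else_)
open import Data.Fin.Base using (Fin; zero; suc)
import Data.Fin.Properties as Fin
open import Data.Fin.Subset using (Subset; _∈_; _∉_; _⊆_; ∣_∣; _─_; Nonempty; inside; outside)
open import Data.Fin.Subset.Properties using (_∈?_; nonempty?; p─q⊆p; x∈p∧x∉q⇒x∈p─q; ∣⊤∣≡n)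
open import Data.List.Base using (List; []; _∷_; _++_; map; filter; length; allFin; cartesianProduct; tabulate)
open import Data.List.Properties using (map-cong; map-++; map-∘)
open import Data.Nat.Base using (ℕ; zero; suc; _≤_; _<_; _+_; _*_; _⊔_; z≤n; s≤s)
open import Data.Nat.Induction using (Acc; acc; <-wellFounded)
open import Data.Nat.ListAction using (sum)
open import Data.Nat.ListAction.Properties using (sum-++)
open import Data.Nat.Properties
  using ( +-assoc; +-comm; +-identityʳ; +-suc; +-commutativeSemigroup; +-mono-≤; +-monoˡ-≤; +-monoʳ-≤; +-cancelʳ-≤
        ; *-zeroʳ; *-identityʳ; *-distribˡ-+; *-monoˡ-≤; *-monoʳ-≤; *-cancelʳ-≤
        ; ≤-refl; ≤-trans; ≤-reflexive; ≰⇒>; <⇒≢; n≤1+n; m≤m+n; m≤n+m; m<m+n; n≢0⇒n>0; n≤0⇒n≡0; m≤m⊔n; m≤n⊔m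
        ; module ≤-Reasoning)
open import Data.Nat.Tactic.RingSolver using (solve-∀)
open import Data.Product.Base using (∃; _×_; _,_; proj₁; proj₂)
open import Data.Sum.Base using (inj₁; inj₂)
import Data.Vec.Base as Vec
open import Data.Vec.Base using ([]; _∷_; there)
open import Data.Vec.Properties using (lookup∘tabulate; []=⇒lookup; lookup⇒[]=)
open import Function.Base using (_∘_)
open import Level using (Level)
open import Relation.Binary.Definitions using (tri<; tri≈; tri>)
open import Relation.Binary.PropositionalEquality using (_≡_; refl; sym; trans; cong; cong₂; subst; module ≡-Reasoning)
open import Relation.Binary.Structures using (IsDecTotalOrder)
open import Relation.Nullary.Decidable using (Dec; yes; no; does; dec-true; _×-dec_)
open import Relation.Nullary.Negation using (¬_; contradiction)
open import Relation.Unary using (Pred; Decidable)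
open import Defs

private
  variable
    a b p : Level
    A : Set a
    B : Set b
    n : ℕ

-- Finite sums over lists.

∑ : List A → (A → ℕ) → ℕ
∑ xs f = sum (map f xs)

∑-cong : ∀ (xs : List A) {f g : A → ℕ} → (∀ x → f x ≡ g x) → ∑ xs f ≡ ∑ xs g
∑-cong xs f≗g = cong sum (map-cong f≗g xs)

∑-mono : ∀ (xs : List A) {f g : A → ℕ} → (∀ x → f x ≤ g x) → ∑ xs f ≤ ∑ xs g
∑-mono []       f≤g = z≤n
∑-mono (x ∷ xs) f≤g = +-mono-≤ (f≤g x) (∑-mono xs f≤g)

∑-0 : ∀ (xs : List A) → ∑ xs (λ _ → 0) ≡ 0
∑-0 []       = refl
∑-0 (x ∷ xs) = ∑-0 xs

∑-+ : ∀ (xs : List A) (f g : A → ℕ) → ∑ xs (λ x → f x + g x) ≡ ∑ xs f + ∑ xs g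
∑-+ []       f g = refl
∑-+ (x ∷ xs) f g = trans (cong (f x + g x +_) (∑-+ xs f g)) (interchange (f x) (g x) _ _)
  where open CommutativeSemigroupProperties +-commutativeSemigroup using (interchange)

∑-*ˡ : ∀ (xs : List A) c (f : A → ℕ) → ∑ xs (λ x → c * f x) ≡ c * ∑ xs f
∑-*ˡ []       c f = sym (*-zeroʳ c)
∑-*ˡ (x ∷ xs) c f = trans (cong (c * f x +_) (∑-*ˡ xs c f)) (sym (*-distribˡ-+ c (f x) _))

∑-swap : ∀ (xs : List A) (ys : List B) (f : A → B → ℕ) →
         ∑ xs (λ x → ∑ ys (f x)) ≡ ∑ ys (λ y → ∑ xs (λ x → f x y))
∑-swap []       ys f = sym (∑-0 ys)
∑-swap (x ∷ xs) ys f = trans (cong (∑ ys (f x) +_) (∑-swap xs ys f)) (sym (∑-+ ys (f x) _))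

∑-cartesianProduct : ∀ (xs : List A) (ys : List B) (f : A × B → ℕ) →
                     ∑ (cartesianProduct xs ys) f ≡ ∑ xs (λ x → ∑ ys (λ y → f (x , y)))
∑-cartesianProduct []       ys f = refl
∑-cartesianProduct (x ∷ xs) ys f = begin
  sum (map f (map (x ,_) ys ++ zs))              ≡⟨ cong sum (map-++ f (map (x ,_) ys) zs) ⟩
  sum (map f (map (x ,_) ys) ++ map f zs)        ≡⟨ sum-++ (map f (map (x ,_) ys)) (map f zs) ⟩
  sum (map f (map (x ,_) ys)) + ∑ zs f           ≡⟨ cong₂ _+_ (cong sum (sym (map-∘ ys))) (∑-cartesianProduct xs ys f) ⟩
  ∑ ys (λ y → f (x , y)) + ∑ xs (λ x → ∑ ys (λ y → f (x , y))) ∎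
  where
  open ≡-Reasoning
  zs = cartesianProduct xs ys

length≡∑1 : ∀ (xs : List A) → length xs ≡ ∑ xs (λ _ → 1)
length≡∑1 []       = refl
length≡∑1 (x ∷ xs) = cong suc (length≡∑1 xs)

module _ {P : Pred A p} (P? : Decidable P) where

  -- With the predicate moved into the summand, sums over different subsets all range over the same
  -- list and can be compared term by term.
  ∑-filter : ∀ xs (f : A → ℕ) → ∑ (filter P? xs) f ≡ ∑ xs (λ x → if does (P? x) then f x else 0)
  ∑-filter []       f = refl
  ∑-filter (x ∷ xs) f with does (P? x)
  ... | true  = cong (f x +_) (∑-filter xs f)
  ... | false = ∑-filter xs f

  ∑-filter-mono : ∀ xs {f g : A → ℕ} → (∀ {x} → P x → f x ≤ g x) → ∑ (filter P? xs) f ≤ ∑ (filter P? xs) g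
  ∑-filter-mono []       f≤g = z≤n
  ∑-filter-mono (x ∷ xs) f≤g with P? x
  ... | yes Px = +-mono-≤ (f≤g Px) (∑-filter-mono xs f≤g)
  ... | no _   = ∑-filter-mono xs f≤g

  -- The index map `g` is arbitrary because the tail of `tabulate g` is `tabulate (g ∘ suc)`, so the
  -- induction leaves the case of the identity, which is the one wanted for `elements`.
  length-filter-tabulate : ∀ (g : Fin n → A) (q : Subset n) → (∀ i → does (P? (g i)) ≡ Vec.lookup q i) →
                           length (filter P? (tabulate g)) ≡ ∣ q ∣
  length-filter-tabulate g []      eq = refl
  length-filter-tabulate g (x ∷ q) eq with does (P? (g zero)) | eq zero | length-filter-tabulate (g ∘ suc) q (eq ∘ suc)
  ... | true  | refl | ih = cong suc ih
  ... | false | refl | ih = ih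

-- Cardinalities of subsets and sums over them.

does-∈? : ∀ (i : Fin n) q → does (i ∈? q) ≡ Vec.lookup q i
does-∈? zero    (inside  ∷ q) = refl
does-∈? zero    (outside ∷ q) = refl
does-∈? (suc i) (x ∷ q)       = does-∈? i q

∣∣≡∑1 : ∀ (q : Subset n) → ∣ q ∣ ≡ ∑ (elements q) (λ _ → 1)
∣∣≡∑1 q = trans (sym (length-filter-tabulate (_∈? q) (λ i → i) q (λ i → does-∈? i q))) (length≡∑1 (elements q))

x∈p─q⇒x∉q : ∀ {x : Fin n} (p q : Subset n) → x ∈ p ─ q → x ∉ q
x∈p─q⇒x∉q (x ∷ p) (inside  ∷ q) (there i∈) (there i∈q) = x∈p─q⇒x∉q p q i∈ i∈q
x∈p─q⇒x∉q (x ∷ p) (outside ∷ q) (there i∈) (there i∈q) = x∈p─q⇒x∉q p q i∈ i∈q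

module _ {P : Pred (Fin n) p} (P? : Decidable P) where

  -- The set `R s` is a tabulation of this kind; this lemma and its converse pass between membership
  -- in it and the property that the algorithm tests.
  ∈-tabulate⁺ : ∀ {v} → P v → v ∈ Vec.tabulate (λ u → does (P? u))
  ∈-tabulate⁺ {v} Pv = lookup⇒[]= v _ (trans (lookup∘tabulate _ v) (dec-true (P? v) Pv))

  ∈-tabulate⁻ : ∀ {v} → v ∈ Vec.tabulate (λ u → does (P? u)) → P v
  ∈-tabulate⁻ {v} v∈ with P? v | trans (sym (lookup∘tabulate (λ u → does (P? u)) v)) ([]=⇒lookup v∈)
  ... | yes Pv | _ = Pv

-- Over the common range `allFin n`, a member of `p` contributes to exactly one of the two sums on
-- the right, and a non-member to neither because `q ⊆ p`.
∑-elements-─ : ∀ {p q : Subset n} → q ⊆ p → (f : Fin n → ℕ) →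
               ∑ (elements p) f ≡ ∑ (elements (p ─ q)) f + ∑ (elements q) f
∑-elements-─ {n} {p} {q} q⊆p f = begin
  ∑ (elements p) f                     ≡⟨ ∑-filter (_∈? p) V f ⟩
  ∑ V (restrict p)                     ≡⟨ ∑-cong V split ⟩
  ∑ V (λ x → restrict (p ─ q) x + restrict q x) ≡⟨ ∑-+ V (restrict (p ─ q)) (restrict q) ⟩
  ∑ V (restrict (p ─ q)) + ∑ V (restrict q)     ≡⟨ cong₂ _+_ (∑-filter (_∈? (p ─ q)) V f) (∑-filter (_∈? q) V f) ⟨
  ∑ (elements (p ─ q)) f + ∑ (elements q) f ∎
  where
  open ≡-Reasoning
  V = allFin n

  restrict : Subset n → Fin n → ℕ
  restrict r x = if does (x ∈? r) then f x else 0

  split : ∀ x → restrict p x ≡ restrict (p ─ q) x + restrict q x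
  split x with x ∈? p | x ∈? (p ─ q) | x ∈? q
  ... | yes _   | yes x∈d | yes x∈q = contradiction x∈q (x∈p─q⇒x∉q p q x∈d)
  ... | yes _   | yes _   | no _    = sym (+-identityʳ (f x))
  ... | yes _   | no _    | yes _   = refl
  ... | yes x∈p | no x∉d  | no x∉q  = contradiction (x∈p∧x∉q⇒x∈p─q x∈p x∉q) x∉d
  ... | no x∉p  | yes x∈d | _       = contradiction (p─q⊆p p q x∈d) x∉p
  ... | no x∉p  | no _    | yes x∈q = contradiction (q⊆p x∈q) x∉p
  ... | no _    | no _    | no _    = refl

∣∣-─ : ∀ {p q : Subset n} → q ⊆ p → ∣ p ∣ ≡ ∣ p ─ q ∣ + ∣ q ∣
∣∣-─ {p = p} {q} q⊆p = begin
  ∣ p ∣                                                   ≡⟨ ∣∣≡∑1 p ⟩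
  ∑ (elements p) (λ _ → 1)                                ≡⟨ ∑-elements-─ q⊆p (λ _ → 1) ⟩
  ∑ (elements (p ─ q)) (λ _ → 1) + ∑ (elements q) (λ _ → 1) ≡⟨ cong₂ _+_ (∣∣≡∑1 (p ─ q)) (∣∣≡∑1 q) ⟨
  ∣ p ─ q ∣ + ∣ q ∣                                       ∎
  where open ≡-Reasoning

∑-elements-const : ∀ (q : Subset n) c → ∑ (elements q) (λ _ → c) ≡ c * ∣ q ∣
∑-elements-const q c = begin
  ∑ (elements q) (λ _ → c)     ≡⟨ ∑-cong (elements q) (λ _ → sym (*-identityʳ c)) ⟩
  ∑ (elements q) (λ _ → c * 1) ≡⟨ ∑-*ˡ (elements q) c (λ _ → 1) ⟩
  c * ∑ (elements q) (λ _ → 1) ≡⟨ cong (c *_) (∣∣≡∑1 q) ⟨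
  c * ∣ q ∣                    ∎
  where open ≡-Reasoning

∈⇒∣∣>0 : ∀ {v : Fin n} {q} → v ∈ q → 0 < ∣ q ∣
∈⇒∣∣>0 {q = inside  ∷ q} _         = s≤s z≤n
∈⇒∣∣>0 {q = outside ∷ q} (there i) = ∈⇒∣∣>0 i

-- The handshake lemma.

module _ (G : SimpleGraph n) where
  open SimpleGraph G renaming (sym to symmetric)

  -- The list `edges` holds each edge once, smaller endpoint first, and `arc` is its indicator. An
  -- adjacency of `v` to `u` is therefore covered by `arc v u` or `arc u v`; exchanging the order of
  -- summation shows that both double sums count the edges.
  handshake : ∑ (allFin n) deg ≤ 2 * edgeCount
  handshake = begin
    ∑ V deg                                           ≡⟨ ∑-cong V (λ v → trans (∣∣≡∑1 (N v)) (∑-filter (_∈? N v) V _)) ⟩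
    ∑ V (λ v → ∑ V (adj v))                           ≤⟨ ∑-mono V (λ v → ∑-mono V (adj≤ v)) ⟩
    ∑ V (λ v → ∑ V (λ u → arc v u + arc u v))         ≡⟨ ∑-cong V (λ v → ∑-+ V (arc v) _) ⟩
    ∑ V (λ v → ∑ V (arc v) + ∑ V (λ u → arc u v))     ≡⟨ ∑-+ V (λ v → ∑ V (arc v)) _ ⟩
    ∑ V (λ v → ∑ V (arc v)) + ∑ V (λ v → ∑ V (λ u → arc u v)) ≡⟨ cong (∑ V (λ v → ∑ V (arc v)) +_) (∑-swap V V (λ v u → arc u v)) ⟩
    ∑ V (λ v → ∑ V (arc v)) + ∑ V (λ v → ∑ V (arc v)) ≡⟨ cong₂ _+_ arcs arcs ⟨
    edgeCount + edgeCount                             ≡⟨ cong (edgeCount +_) (+-identityʳ edgeCount) ⟨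
    2 * edgeCount                                     ∎
    where
    open ≤-Reasoning
    V = allFin n

    adj arc : Fin n → Fin n → ℕ
    adj v u = if does (u ∈? N v) then 1 else 0
    arc u v = if does ((u Fin.<? v) ×-dec (v ∈? N u)) then 1 else 0

    arcs : edgeCount ≡ ∑ V (λ v → ∑ V (arc v))
    arcs = trans (length≡∑1 edges)
      (trans (∑-filter _ (cartesianProduct V V) (λ _ → 1)) (∑-cartesianProduct V V _))

    adj≤ : ∀ v u → adj v u ≤ arc v u + arc u v
    adj≤ v u with u ∈? N v
    ... | no _ = z≤n
    ... | yes u∈Nv with Fin.<-cmp v u
    ...   | tri≈ _ refl _ = contradiction u∈Nv irrefl
    ...   | tri< v<u _ _ rewrite dec-true (v Fin.<? u) v<u = s≤s z≤n
    -- Here the edge is listed from `u` to `v`, so the adjacency has to be reversed by symmetry.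
    ...   | tri> _ _ u<v rewrite dec-true (u Fin.<? v) u<v | dec-true (v ∈? N u) (symmetric u∈Nv) = m≤n+m 1 _

-- Ordered fields and the natural numbers in them.

module OrderedFieldProperties {c ℓ₁ ℓ₂} (F : ArchimedeanOrderedField c ℓ₁ ℓ₂) where
  private module F = ArchimedeanOrderedField F
  open F
    hiding (reflexive; +-comm; +-assoc; +-identityʳ; *-identityʳ; +-monoʳ-≤)
    renaming (_≤_ to _≤ᶠ_; _+_ to _+ᶠ_; _*_ to _*ᶠ_; refl to ≈-refl; sym to ≈-sym; trans to ≈-trans; _<_ to _<ᶠ_)
  open IsDecTotalOrder isDecTotalOrder
    using (total; antisym; reflexive)
    renaming (trans to ≤ᶠ-trans; ≤-respˡ-≈ to respˡ; ≤-respʳ-≈ to respʳ)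
  open RingProperties ring using (-1*x≈-x; -‿involutive)
  open Mult semiring using (×1-homo-*; ×-homo-+)
  open CommutativeSemigroupProperties *-commutativeSemigroup using (x∙yz≈y∙xz)
  open import Relation.Binary.Reasoning.Setoid setoid

  x≤y⇒0≤y-x : ∀ {x y} → x ≤ᶠ y → 0# ≤ᶠ - x +ᶠ y
  x≤y⇒0≤y-x {x} x≤y = respˡ (-‿inverseˡ x) (F.+-monoʳ-≤ (- x) x≤y)

  x+[-x+y]≈y : ∀ x y → x +ᶠ (- x +ᶠ y) ≈ y
  x+[-x+y]≈y x y = begin
    x +ᶠ (- x +ᶠ y) ≈⟨ F.+-assoc x (- x) y ⟨
    x +ᶠ - x +ᶠ y   ≈⟨ +-congʳ (-‿inverseʳ x) ⟩
    0# +ᶠ y         ≈⟨ +-identityˡ y ⟩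
    y               ∎

  -- The axiom concerns products of nonnegative elements, so it is applied to `z` and the difference
  -- `- x +ᶠ y`; then `z *ᶠ x` is added back.
  *-monoʳ-≤ᶠ : ∀ {z x y} → 0# ≤ᶠ z → x ≤ᶠ y → z *ᶠ x ≤ᶠ z *ᶠ y
  *-monoʳ-≤ᶠ {z} {x} {y} 0≤z x≤y =
    respˡ (F.+-identityʳ _) (respʳ eq (F.+-monoʳ-≤ (z *ᶠ x) (*-nonNegative 0≤z (x≤y⇒0≤y-x x≤y))))
    where
    eq : z *ᶠ x +ᶠ z *ᶠ (- x +ᶠ y) ≈ z *ᶠ y
    eq = ≈-trans (≈-sym (distribˡ z x _)) (*-congˡ (x+[-x+y]≈y x y))

  0≤1 : 0# ≤ᶠ 1#
  0≤1 with total 0# 1#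
  ... | inj₁ 0≤1 = 0≤1
  -- If 1 were at most 0, then -1 would be nonnegative, and so would its square, which is 1.
  ... | inj₂ 1≤0 = respʳ (≈-trans (-1*x≈-x _) (-‿involutive 1#)) (*-nonNegative 0≤-1 0≤-1)
    where
    0≤-1 : 0# ≤ᶠ - 1#
    0≤-1 = respʳ (F.+-identityʳ _) (x≤y⇒0≤y-x 1≤0)

  1≰0 : ¬ (1# ≤ᶠ 0#)
  1≰0 1≤0 = 0≉1 (antisym 0≤1 1≤0)

  -- Were `x ⁻¹` at most 0, multiplication by `x` would give `1# ≤ᶠ 0#`.
  ⁻¹-nonNegative : ∀ {x} → 0# ≤ᶠ x → ¬ (x ≈ 0#) → 0# ≤ᶠ x ⁻¹
  ⁻¹-nonNegative {x} 0≤x x≉0 with total 0# (x ⁻¹)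
  ... | inj₁ 0≤x⁻¹ = 0≤x⁻¹
  ... | inj₂ x⁻¹≤0 = contradiction (respˡ (⁻¹-inverseʳ x≉0) (respʳ (zeroʳ x) (*-monoʳ-≤ᶠ 0≤x x⁻¹≤0))) 1≰0

  x⁻¹*[x*y]≈y : ∀ {x} y → ¬ (x ≈ 0#) → x ⁻¹ *ᶠ (x *ᶠ y) ≈ y
  x⁻¹*[x*y]≈y {x} y x≉0 = begin
    x ⁻¹ *ᶠ (x *ᶠ y) ≈⟨ *-assoc _ x y ⟨
    x ⁻¹ *ᶠ x *ᶠ y   ≈⟨ *-congʳ (≈-trans (*-comm _ x) (⁻¹-inverseʳ x≉0)) ⟩
    1# *ᶠ y          ≈⟨ *-identityˡ y ⟩
    y                ∎

  *-cancelˡ-≤ᶠ : ∀ {z x y} → 0# ≤ᶠ z → ¬ (z ≈ 0#) → z *ᶠ x ≤ᶠ z *ᶠ y → x ≤ᶠ y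
  *-cancelˡ-≤ᶠ {z} {x} {y} 0≤z z≉0 zx≤zy =
    respˡ (x⁻¹*[x*y]≈y x z≉0) (respʳ (x⁻¹*[x*y]≈y y z≉0) (*-monoʳ-≤ᶠ (⁻¹-nonNegative 0≤z z≉0) zx≤zy))

  fromℕ-+ : ∀ i j → fromℕ (i + j) ≈ fromℕ i +ᶠ fromℕ j
  fromℕ-+ = ×-homo-+ 1#

  fromℕ-* : ∀ i j → fromℕ (i * j) ≈ fromℕ i *ᶠ fromℕ j
  fromℕ-* = ×1-homo-*

  fromℕ-nonNegative : ∀ i → 0# ≤ᶠ fromℕ i
  fromℕ-nonNegative zero    = reflexive ≈-refl
  fromℕ-nonNegative (suc i) = ≤ᶠ-trans 0≤1 (respˡ (F.+-identityʳ 1#) (F.+-monoʳ-≤ 1# (fromℕ-nonNegative i)))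

  fromℕ-mono : ∀ {i j} → i ≤ j → fromℕ i ≤ᶠ fromℕ j
  fromℕ-mono {j = j} z≤n = fromℕ-nonNegative j
  fromℕ-mono (s≤s i≤j)   = F.+-monoʳ-≤ 1# (fromℕ-mono i≤j)

  fromℕ≉0 : ∀ {i} → 0 < i → ¬ (fromℕ i ≈ 0#)
  fromℕ≉0 0<i i≈0 = 1≰0 (respˡ (F.+-identityʳ 1#) (respʳ i≈0 (fromℕ-mono 0<i)))

  -- Here and below, the k of the header is suc k.
  ∃1≤k*x : ∀ {x} → Positive x → ∃ λ k → 1# ≤ᶠ fromℕ (suc k) *ᶠ x
  ∃1≤k*x {x} (0≤x , 0≉x) = k , respˡ (⁻¹-inverseʳ (0≉x ∘ ≈-sym))
    (respʳ (*-comm x _) (*-monoʳ-≤ᶠ 0≤x (≤ᶠ-trans x⁻¹≤k (fromℕ-mono (n≤1+n k)))))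
    where
    k = proj₁ (archimedean (x ⁻¹))
    x⁻¹≤k = proj₂ (archimedean (x ⁻¹))

  -- This replaces the field comparison made by the algorithm with one between natural numbers.
  -- Write `K` for `fromℕ (suc k)`. After multiplication by `K` and `fromℕ u` the goal bounds
  -- `K u d` by `K (1 + ε) S = (K ε + K) S`, and `1 ≤ K ε` makes this at least `(1 + K) S`.
  ≤-scaledMean : ∀ {ε} k u d S → 1# ≤ᶠ fromℕ (suc k) *ᶠ ε → 0 < u →
                 suc k * u * d ≤ (2 + k) * S →
                 fromℕ d ≤ᶠ (1# +ᶠ ε) *ᶠ (fromℕ u ⁻¹ *ᶠ fromℕ S)
  ≤-scaledMean {ε} k u d S 1≤kε 0<u kud≤[1+k]S =
    *-cancelˡ-≤ᶠ (fromℕ-nonNegative u) (fromℕ≉0 0<u)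
      (*-cancelˡ-≤ᶠ (fromℕ-nonNegative (suc k)) (fromℕ≉0 {suc k} (s≤s z≤n))
        (respˡ lhs (respʳ rhs
          (≤ᶠ-trans (fromℕ-mono kud≤[1+k]S)
            (respˡ (≈-sym expand) (*-monoʳ-≤ᶠ (fromℕ-nonNegative S) (+-monoˡ 1≤kε)))))))
    where
    K = fromℕ (suc k)
    +-monoˡ : ∀ {x y z} → x ≤ᶠ y → x +ᶠ z ≤ᶠ y +ᶠ z
    +-monoˡ x≤y = respˡ (F.+-comm _ _) (respʳ (F.+-comm _ _) (F.+-monoʳ-≤ _ x≤y))

    lhs : fromℕ (suc k * u * d) ≈ K *ᶠ (fromℕ u *ᶠ fromℕ d)
    lhs = begin
      fromℕ (suc k * u * d)           ≈⟨ fromℕ-* (suc k * u) d ⟩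
      fromℕ (suc k * u) *ᶠ fromℕ d    ≈⟨ *-congʳ (fromℕ-* (suc k) u) ⟩
      K *ᶠ fromℕ u *ᶠ fromℕ d         ≈⟨ *-assoc K _ _ ⟩
      K *ᶠ (fromℕ u *ᶠ fromℕ d)       ∎

    expand : fromℕ ((2 + k) * S) ≈ fromℕ S *ᶠ (1# +ᶠ K)
    expand = ≈-trans (fromℕ-* (2 + k) S) (*-comm _ _)

    rhs : fromℕ S *ᶠ (K *ᶠ ε +ᶠ K) ≈ K *ᶠ (fromℕ u *ᶠ ((1# +ᶠ ε) *ᶠ (fromℕ u ⁻¹ *ᶠ fromℕ S)))
    rhs = begin
      fromℕ S *ᶠ (K *ᶠ ε +ᶠ K)                  ≈⟨ *-congˡ (+-congˡ (F.*-identityʳ K)) ⟨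
      fromℕ S *ᶠ (K *ᶠ ε +ᶠ K *ᶠ 1#)            ≈⟨ *-congˡ (distribˡ K ε 1#) ⟨
      fromℕ S *ᶠ (K *ᶠ (ε +ᶠ 1#))               ≈⟨ *-congˡ (*-congˡ (F.+-comm ε 1#)) ⟩
      fromℕ S *ᶠ (K *ᶠ (1# +ᶠ ε))               ≈⟨ x∙yz≈y∙xz _ K _ ⟩
      K *ᶠ (fromℕ S *ᶠ (1# +ᶠ ε))               ≈⟨ *-congˡ (*-comm _ _) ⟩
      K *ᶠ ((1# +ᶠ ε) *ᶠ fromℕ S)               ≈⟨ *-congˡ (*-congˡ (x⁻¹*[x*y]≈y _ (fromℕ≉0 0<u))) ⟨
      K *ᶠ ((1# +ᶠ ε) *ᶠ (fromℕ u ⁻¹ *ᶠ (fromℕ u *ᶠ fromℕ S)))  ≈⟨ *-congˡ (*-congˡ (x∙yz≈y∙xz _ (fromℕ u) _)) ⟩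
      K *ᶠ ((1# +ᶠ ε) *ᶠ (fromℕ u *ᶠ (fromℕ u ⁻¹ *ᶠ fromℕ S)))  ≈⟨ *-congˡ (x∙yz≈y∙xz _ (fromℕ u) _) ⟩
      K *ᶠ (fromℕ u *ᶠ ((1# +ᶠ ε) *ᶠ (fromℕ u ⁻¹ *ᶠ fromℕ S)))  ∎

-- The proportion of `U` removed by one iteration.

*-cancelʳ-≤-suc : ∀ k S u u′ → suc ((2 + k) * S) * u′ ≤ suc k * u * S → (2 + k) * u′ ≤ suc k * u
-- For `S = 0` no cancellation is possible. The hypothesis then says `u′ ≤ 0`, thanks to the `suc`
-- that records a strict inequality.
*-cancelʳ-≤-suc k zero u zero le = subst (_≤ suc k * u) (sym (*-zeroʳ k)) z≤n
*-cancelʳ-≤-suc k zero u (suc u′) le = contradiction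
  (subst (suc u′ ≤_) (*-zeroʳ (suc k * u)) (≤-trans (m≤m+n (suc u′) _) le)) λ ()
*-cancelʳ-≤-suc k S@(suc _) u u′ le = *-cancelʳ-≤ ((2 + k) * u′) (suc k * u) S (begin
  (2 + k) * u′ * S        ≡⟨ shuffle k u′ S ⟩
  (2 + k) * S * u′        ≤⟨ *-monoˡ-≤ u′ (n≤1+n ((2 + k) * S)) ⟩
  suc ((2 + k) * S) * u′  ≤⟨ le ⟩
  suc k * u * S           ∎)
  where
  open ≤-Reasoning
  shuffle : ∀ k u′ S → (2 + k) * u′ * S ≡ (2 + k) * S * u′
  shuffle = solve-∀

module _ {c ℓ₁ ℓ₂} (F : ArchimedeanOrderedField c ℓ₁ ℓ₂) (ε : ArchimedeanOrderedField.Carrier F) where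
  open Algorithm F ε
  open ArchimedeanOrderedField F using (fromℕ; 1#; _≤?_) renaming (_≤_ to _≤ᶠ_; _+_ to _+ᶠ_; _*_ to _*ᶠ_)
  open OrderedFieldProperties F using (≤-scaledMean)

  module _ (s : State n) where

    -- Repeats the test inside the definition of `R`, so that `R s` is by computation the tabulation
    -- of `selected?`.
    selected? : ∀ u → Dec (u ∈ U s × fromℕ (D s u) ≤ᶠ (1# +ᶠ ε) *ᶠ δ̂ s)
    selected? u = (u ∈? U s) ×-dec (fromℕ (D s u) ≤? (1# +ᶠ ε) *ᶠ δ̂ s)

    R⊆U : R s ⊆ U s
    R⊆U = proj₁ ∘ ∈-tabulate⁻ selected?

    ∣U∣≡∣U─R∣+∣R∣ : ∣ U s ∣ ≡ ∣ U s ─ R s ∣ + ∣ R s ∣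
    ∣U∣≡∣U─R∣+∣R∣ = ∣∣-─ R⊆U

    module _ (k : ℕ) (1≤kε : 1# ≤ᶠ fromℕ (suc k) *ᶠ ε) where

      private
        u = ∣ U s ∣
        u′ = ∣ U s ─ R s ∣
        S = ∑ (elements (U s)) (D s)

      -- If the inequality failed, `≤-scaledMean` would make `v` pass the test and put it in `R s`.
      -- The vertex `v` itself shows that `U s` is nonempty, so that the mean is a true quotient.
      unselected : ∀ {v} → v ∈ U s ─ R s → (2 + k) * S < suc k * u * D s v
      unselected {v} v∈ = ≰⇒> λ le → x∈p─q⇒x∉q (U s) (R s) v∈
        (∈-tabulate⁺ selected? (v∈U , ≤-scaledMean k u (D s v) S 1≤kε (∈⇒∣∣>0 v∈U) le))
        where
        v∈U : v ∈ U s
        v∈U = p─q⊆p (U s) (R s) v∈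

      ∑-unselected : suc ((2 + k) * S) * u′ ≤ suc k * u * S
      ∑-unselected = begin
        suc ((2 + k) * S) * u′                           ≡⟨ ∑-elements-const (U s ─ R s) _ ⟨
        ∑ (elements (U s ─ R s)) (λ _ → suc ((2 + k) * S)) ≤⟨ ∑-filter-mono (_∈? (U s ─ R s)) (allFin n) unselected ⟩
        ∑ (elements (U s ─ R s)) (λ v → suc k * u * D s v) ≡⟨ ∑-*ˡ (elements (U s ─ R s)) (suc k * u) (D s) ⟩
        -- The values of `D` are natural numbers, so adding the selected vertices back can only
        -- enlarge the sum.
        suc k * u * ∑ (elements (U s ─ R s)) (D s)       ≤⟨ *-monoʳ-≤ (suc k * u) (m≤m+n _ _) ⟩
        suc k * u * (∑ (elements (U s ─ R s)) (D s) + ∑ (elements (R s)) (D s)) ≡⟨ cong (suc k * u *_) (∑-elements-─ R⊆U (D s)) ⟨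
        suc k * u * S                                    ∎
        where open ≤-Reasoning

      ∣U∣≤[2+k]∣R∣ : ∣ U s ∣ ≤ (2 + k) * ∣ R s ∣
      ∣U∣≤[2+k]∣R∣ = begin
        u             ≡⟨ ∣U∣≡∣U─R∣+∣R∣ ⟩
        u′ + r        ≤⟨ +-monoˡ-≤ r u′≤ ⟩
        suc k * r + r ≡⟨ +-comm (suc k * r) r ⟩
        (2 + k) * r   ∎
        where
        open ≤-Reasoning
        r = ∣ R s ∣
        u′≤ : u′ ≤ suc k * r
        -- Since `(2 + k) * u′` computes to `u′ + suc k * u′`, replacing `u` by `u′ + r` lets
        -- `suc k * u′` cancel on both sides.
        u′≤ = +-cancelʳ-≤ (suc k * u′) u′ (suc k * r) (begin
          (2 + k) * u′              ≤⟨ *-cancelʳ-≤-suc k S u u′ ∑-unselected ⟩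
          suc k * u                 ≡⟨ cong (suc k *_) ∣U∣≡∣U─R∣+∣R∣ ⟩
          suc k * (u′ + r)          ≡⟨ *-distribˡ-+ (suc k) u′ r ⟩
          suc k * u′ + suc k * r    ≡⟨ +-comm (suc k * u′) _ ⟩
          suc k * r + suc k * u′    ∎)

  -- Amortised work of the loop and of the whole run.

  module _ (k : ℕ) (1≤kε : 1# ≤ᶠ fromℕ (suc k) *ᶠ ε) (I : Implementation) (G : SimpleGraph n) where
    open Implementation I
    open SimpleGraph G using (deg; edgeCount)

    -- The coefficient adds 3 for the phases of unit budget, `2 * (2 + k)` for the two phases linear
    -- in `∣ U s ∣`, and 2 for the two linear in `∣ R s ∣`. The degree sum pays for `updateD`.
    price : Subset n → ℕ
    price q = (9 + 2 * k) * ∣ q ∣ + ∑ (elements q) deg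

    price-─ : ∀ s → price (U s) ≡ price (R s) + price (U s ─ R s)
    price-─ s = trans (cong₂ (λ x y → (9 + 2 * k) * x + y) (∣U∣≡∣U─R∣+∣R∣ s) (∑-elements-─ (R⊆U s) deg))
      (regroup (9 + 2 * k) ∣ U s ─ R s ∣ ∣ R s ∣ _ _)
      where
      regroup : ∀ w a b c d → w * (a + b) + (c + d) ≡ w * b + d + (w * a + c)
      regroup = solve-∀

    -- The bracketing follows the composition in `body`, so the bounds of the phases combine along
    -- it one by one.
    iterationBudget : State n → ℕ
    iterationBudget s = cost testU + (cost reduceU + (cost averageD + (cost selectR
      + (cost updateD + (cost removeR + (cost assignρ + cost incrementℓ))))))
      where
      cost : Phase → ℕ
      cost phase = budget G phase s

    work-iteration : ∀ s → work (perform G testU s) + work (body I G s) ≤ κ * iterationBudget s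
    work-iteration s =
      testU ⊕ reduceU ⊕ averageD ⊕ selectR ⊕ updateD ⊕ removeR ⊕ assignρ ⊕ perform-work G incrementℓ s
      where
      infixr 5 _⊕_
      _⊕_ : ∀ p {x y} → x ≤ κ * y → work (perform G p s) + x ≤ κ * (budget G p s + y)
      _⊕_ p {y = y} x≤ = ≤-trans (+-mono-≤ (perform-work G p s) x≤)
        (≤-reflexive (sym (*-distribˡ-+ κ (budget G p s) y)))

    iterationBudget≤price : ∀ s → 0 < ∣ R s ∣ → iterationBudget s ≤ price (R s)
    iterationBudget≤price s 0<r = begin
      iterationBudget s                     ≡⟨ collect ∣ U s ∣ ∣ R s ∣ d ⟩
      -- As `R s` is nonempty, the three unit budgets are charged to its vertices.
      3 * 1 + 2 * ∣ U s ∣ + 2 * ∣ R s ∣ + d ≤⟨ +-monoˡ-≤ d (+-monoˡ-≤ (2 * r) (+-mono-≤ (*-monoʳ-≤ 3 0<r) (*-monoʳ-≤ 2 (∣U∣≤[2+k]∣R∣ s k 1≤kε)))) ⟩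
      3 * r + 2 * ((2 + k) * r) + 2 * r + d ≡⟨ cong (_+ d) (factor k r) ⟩
      price (R s)                           ∎
      where
      open ≤-Reasoning
      r = ∣ R s ∣
      d = ∑ (elements (R s)) deg
      collect : ∀ u r d → 1 + (u + (1 + (u + (d + (r + (r + 1)))))) ≡ 3 * 1 + 2 * u + 2 * r + d
      collect = solve-∀
      factor : ∀ k r → 3 * r + 2 * ((2 + k) * r) + 2 * r ≡ (9 + 2 * k) * r
      factor = solve-∀

    -- Used twice: it makes `∣ U s ∣` decrease, and it lets the constant cost of an iteration be
    -- charged to a removed vertex.
    R-inhabited : ∀ (s : State n) → Nonempty (U s) → 0 < ∣ R s ∣
    R-inhabited s (_ , v∈U) = n≢0⇒n>0 λ r≡0 → <⇒≢ (∈⇒∣∣>0 v∈U) (sym (n≤0⇒n≡0 (begin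
      ∣ U s ∣           ≤⟨ ∣U∣≤[2+k]∣R∣ s k 1≤kε ⟩
      (2 + k) * ∣ R s ∣ ≡⟨ cong ((2 + k) *_) r≡0 ⟩
      (2 + k) * 0       ≡⟨ *-zeroʳ (2 + k) ⟩
      0                 ∎)))
      where open ≤-Reasoning

    -- Termination and the bound come from one well-founded induction on `∣ U s ∣`. The price of
    -- `R s` pays for the current iteration and the rest of the price for the later ones; the
    -- summand 1 covers the final test, which finds `U` empty.
    loop-work : ∀ s → Acc _<_ ∣ U s ∣ → ∃ λ c → Loop I G s c × work c ≤ κ * (1 + price (U s))
    loop-work s (acc rec) with nonempty? (U s)
    ... | no empty = _ , exit empty , ≤-trans (perform-work G testU s) (*-monoʳ-≤ κ (s≤s z≤n))
    ... | yes nonempty with loop-work (step G s) (rec U′<U)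
      where
      U′<U : ∣ U s ─ R s ∣ < ∣ U s ∣
      U′<U = subst (∣ U s ─ R s ∣ <_) (sym (∣U∣≡∣U─R∣+∣R∣ s)) (m<m+n _ (R-inhabited s nonempty))
    ...   | c , l , work≤ = _ , iterate nonempty l , (begin
      work (perform G testU s) + (work (body I G s) + work c)  ≡⟨ +-assoc (work (perform G testU s)) _ _ ⟨
      work (perform G testU s) + work (body I G s) + work c    ≤⟨ +-mono-≤ (work-iteration s) work≤ ⟩
      κ * iterationBudget s + κ * (1 + price (U s ─ R s))      ≡⟨ *-distribˡ-+ κ (iterationBudget s) _ ⟨
      κ * (iterationBudget s + (1 + price (U s ─ R s)))        ≤⟨ *-monoʳ-≤ κ (+-monoˡ-≤ _ (iterationBudget≤price s (R-inhabited s nonempty))) ⟩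
      κ * (price (R s) + (1 + price (U s ─ R s)))              ≡⟨ cong (κ *_) (+-suc (price (R s)) _) ⟩
      κ * (1 + (price (R s) + price (U s ─ R s)))              ≡⟨ cong (λ x → κ * (1 + x)) (price-─ s) ⟨
      κ * (1 + price (U s))                                    ∎)
      where open ≤-Reasoning

    price-initial : price (U (initial G)) ≤ (9 + 2 * k) * n + 2 * edgeCount
    price-initial = +-mono-≤ (≤-reflexive (cong ((9 + 2 * k) *_) (∣⊤∣≡n n))) (begin
      ∑ (elements (U (initial G))) deg      ≡⟨ ∑-filter (_∈? U (initial G)) (allFin n) deg ⟩
      ∑ (allFin n) _                        ≤⟨ ∑-mono (allFin n) (λ v → restrict≤ (does (v ∈? U (initial G))) (deg v)) ⟩
      ∑ (allFin n) deg                      ≤⟨ handshake G ⟩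
      2 * edgeCount                         ∎)
      where
      open ≤-Reasoning
      restrict≤ : ∀ b x → (if b then x else 0) ≤ x
      restrict≤ true  x = ≤-refl
      restrict≤ false x = z≤n

    adg-work : ∃ λ c → ADG I G c × work c ≤ κ * (12 + 2 * k) * (1 ⊔ (n + edgeCount))
    adg-work with loop-work (initial G) (<-wellFounded _)
    ... | c , l , work≤ = _ , run l , (begin
      work (initialise G) + work c                         ≤⟨ +-mono-≤ (initialise-work G) work≤ ⟩
      κ * suc n + κ * (1 + price (U (initial G)))          ≡⟨ *-distribˡ-+ κ (suc n) _ ⟨
      κ * (suc n + (1 + price (U (initial G))))            ≤⟨ *-monoʳ-≤ κ (+-monoʳ-≤ (suc n) (s≤s price-initial)) ⟩
      -- The edge term is padded so that `n` and `m` share the coefficient `10 + 2 * k`. The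
      -- remaining 2, from `initialise` and the final test, is absorbed by the maximum with 1, also
      -- when the graph has no vertices.
      κ * (suc n + (1 + ((9 + 2 * k) * n + 2 * m)))        ≤⟨ *-monoʳ-≤ κ (m≤m+n _ ((8 + 2 * k) * m)) ⟩
      κ * (suc n + (1 + ((9 + 2 * k) * n + 2 * m)) + (8 + 2 * k) * m) ≡⟨ cong (κ *_) (collect k n m) ⟩
      κ * (2 * 1 + (10 + 2 * k) * (n + m))                 ≤⟨ *-monoʳ-≤ κ (+-mono-≤ (*-monoʳ-≤ 2 (m≤m⊔n 1 (n + m))) (*-monoʳ-≤ (10 + 2 * k) (m≤n⊔m 1 (n + m)))) ⟩
      κ * (2 * t + (10 + 2 * k) * t)                       ≡⟨ factor κ k t ⟩
      κ * (12 + 2 * k) * t                                 ∎)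
      where
      open ≤-Reasoning
      m = edgeCount
      t = 1 ⊔ (n + m)
      collect : ∀ k n m → suc n + (1 + ((9 + 2 * k) * n + 2 * m)) + (8 + 2 * k) * m ≡ 2 * 1 + (10 + 2 * k) * (n + m)
      collect = solve-∀
      factor : ∀ κ k t → κ * (2 * t + (10 + 2 * k) * t) ≡ κ * (12 + 2 * k) * t
      factor = solve-∀

lemma2 : ∀ {a ℓ₁ ℓ₂ : Level} (F : ArchimedeanOrderedField a ℓ₁ ℓ₂) →
    (ε : ArchimedeanOrderedField.Carrier F) → ArchimedeanOrderedField.Positive F ε →
    (I : Algorithm.Implementation F ε) →
    ∃ λ (C : ℕ) → ∀ (n : ℕ) (G : SimpleGraph n) →
    ∃ λ (c : Computation) → Algorithm.ADG F ε I G c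
    × work c ≤ C * (1 ⊔ (n + SimpleGraph.edgeCount G))
-- The number `k` comes from `ε` and `κ` from the implementation, so the constant is fixed before
-- any graph is given.
lemma2 F ε 0<ε I with OrderedFieldProperties.∃1≤k*x F 0<ε
... | k , 1≤kε = Algorithm.Implementation.κ I * (12 + 2 * k) , λ n G → adg-work F ε k 1≤kε I G
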